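{- Let $3\le n,q<\omega$, $0\le m\le n$ and $0\le p\le q$. Then $L_6(p,q)\in\mathbf{V}(L_6(m,n))$ if and only if $p\le m$ and either (a) $p=q=m=n$, or (b) $p<q$ and $q\le p+\lfloor (m-p)/2\rfloor+n-m$.
   Context: For a finite set $S$ with $|S|\ge3$ and $I\subseteq S$, $Q_6(I,S)$ is the finite $pm$-space on $S\cup\zeta(S)$, where $\zeta(S)$ is a disjoint copy of $S$, $\zeta$ interchanges each $s\in S$ with its copy $\zeta(s)$, the topology is discrete, and the only strict comparabilities are: for $x,y\in S$, $x<\zeta(y)$ iff ($x\ne y$ or $x\notin I$). $Q_6(m,n)$ denotes $Q_6(I,S)$ with $|S|=n$, $|I|=m$ (unique up to isomorphism). $L_6(m,n)$ is its dual pseudocomplemented de Morgan algebra: the clopen (here: all) decreasing subsets $X$ of $Q_6(m,n)$ with $\cap,\cup,\emptyset$, the whole set, $X^\ast=$ complement of the up-set $[X)$, and $X'=$ complement of $\zeta(X)$. $\mathbf{V}(A)$ denotes the variety generated by $A$. -}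

module Defs where

open import Level using (0ℓ) renaming (suc to lsuc)
open import Data.Bool using (Bool; true; false; T; not)
  renaming (_∧_ to _and_; _∨_ to _or_)
open import Data.Bool.Properties using (T?)
open import Data.Empty using (⊥-elim)
open import Data.Nat using (ℕ)
open import Data.Fin using (Fin)
import Data.Fin.Properties as Fin
open import Data.Fin.Subset using (Subset) renaming (_∉_ to _∉ₛ_)
open import Data.Fin.Subset.Properties using () renaming (_∈?_ to _∈ₛ?_)
open import Data.List using (List; map; _++_; allFin)
open import Data.List.Membership.Propositional using (find; lose)
  renaming (_∈_ to _∈ₗ_)
open import Data.List.Membership.Propositional.Properties
  using (∈-++⁺ˡ; ∈-++⁺ʳ; ∈-map⁺; ∈-allFin)
open import Data.List.Relation.Unary.Any using (any?)
open import Data.Product using (∃; _×_; _,_)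
open import Data.Sum using (_⊎_; inj₁; inj₂; swap)
open import Data.Sum.Properties using (≡-dec; swap-involutive)
open import Function using (_∘_)
open import Function.Definitions using (Injective; Surjective)
open import Relation.Nullary using (¬_; Dec; yes; no; does)
open import Relation.Nullary.Decidable using (map′; _×-dec_; _⊎-dec_; ¬?)
open import Relation.Unary using (Pred; Decidable; _∈_)
open import Relation.Binary using (Rel; IsEquivalence; IsDecPartialOrder;
  IsStrictPartialOrder; IsDecStrictPartialOrder)
  renaming (Decidable to Decidable₂)
open import Relation.Binary.Construct.Closure.Reflexive using (ReflClosure; refl; [_])
import Relation.Binary.Construct.Closure.Reflexive.Properties as Refl
open import Relation.Binary.PropositionalEquality as ≡
  using (_≡_; _≢_; cong; cong₂; subst)

------------------------------------------------------------------------
-- Algebras of type (2,2,0,0,1,1), the similarity type of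
-- pseudocomplemented de Morgan algebras

record Algebra : Set₁ where
  infixr 7 _∧_
  infixr 6 _∨_
  infix  8 _* _′
  infix  4 _≈_
  field
    Carrier       : Set
    _≈_           : Rel Carrier 0ℓ
    isEquivalence : IsEquivalence _≈_
    _∧_ _∨_       : Carrier → Carrier → Carrier
    𝟎 𝟏           : Carrier
    _* _′         : Carrier → Carrier
    ∧-cong        : ∀ {x y u v} → x ≈ y → u ≈ v → (x ∧ u) ≈ (y ∧ v)
    ∨-cong        : ∀ {x y u v} → x ≈ y → u ≈ v → (x ∨ u) ≈ (y ∨ v)
    *-cong        : ∀ {x y} → x ≈ y → (x *) ≈ (y *)
    ′-cong        : ∀ {x y} → x ≈ y → (x ′) ≈ (y ′)

  open IsEquivalence isEquivalence public

record Hom (A B : Algebra) : Set where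
  private
    module A = Algebra A
    module B = Algebra B
  field
    ⟦_⟧    : A.Carrier → B.Carrier
    ⟦⟧-cong : ∀ {x y} → x A.≈ y → ⟦ x ⟧ B.≈ ⟦ y ⟧
    ∧-homo : ∀ x y → ⟦ x A.∧ y ⟧ B.≈ (⟦ x ⟧ B.∧ ⟦ y ⟧)
    ∨-homo : ∀ x y → ⟦ x A.∨ y ⟧ B.≈ (⟦ x ⟧ B.∨ ⟦ y ⟧)
    𝟎-homo : ⟦ A.𝟎 ⟧ B.≈ B.𝟎
    𝟏-homo : ⟦ A.𝟏 ⟧ B.≈ B.𝟏
    *-homo : ∀ x → ⟦ x A.* ⟧ B.≈ (⟦ x ⟧ B.*)
    ′-homo : ∀ x → ⟦ x A.′ ⟧ B.≈ (⟦ x ⟧ B.′)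

-- Subalgebras are taken up to isomorphism, as embeddings.
IsEmbedding IsOnto : ∀ {A B} → Hom A B → Set
IsEmbedding {A} {B} h = Injective (Algebra._≈_ A) (Algebra._≈_ B) (Hom.⟦_⟧ h)
IsOnto      {A} {B} h = Surjective (Algebra._≈_ A) (Algebra._≈_ B) (Hom.⟦_⟧ h)

∏ : (X : Set) → (X → Algebra) → Algebra
∏ X A = record
  { Carrier       = ∀ i → Carrier (A i)
  ; _≈_           = λ f g → ∀ i → _≈_ (A i) (f i) (g i)
  ; isEquivalence = record
    { refl  = λ i → Algebra.refl (A i)
    ; sym   = λ p i → Algebra.sym (A i) (p i)
    ; trans = λ p q i → Algebra.trans (A i) (p i) (q i)
    }
  ; _∧_    = λ f g i → _∧_ (A i) (f i) (g i)
  ; _∨_    = λ f g i → _∨_ (A i) (f i) (g i)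
  ; 𝟎      = λ i → 𝟎 (A i)
  ; 𝟏      = λ i → 𝟏 (A i)
  ; _*     = λ f i → _* (A i) (f i)
  ; _′     = λ f i → _′ (A i) (f i)
  ; ∧-cong = λ p q i → ∧-cong (A i) (p i) (q i)
  ; ∨-cong = λ p q i → ∨-cong (A i) (p i) (q i)
  ; *-cong = λ p i → *-cong (A i) (p i)
  ; ′-cong = λ p i → ′-cong (A i) (p i)
  }
  where open Algebra

-- The level of the predicate is high enough for the class HSP(A), whose
-- membership quantifies over index sets and algebras, to be an instance.
record IsVariety (K : Pred Algebra (lsuc 0ℓ)) : Set₁ where
  field
    H-closed : ∀ {A B} (h : Hom A B) → IsOnto h → A ∈ K → B ∈ K
    S-closed : ∀ {A B} (h : Hom A B) → IsEmbedding h → B ∈ K → A ∈ K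
    P-closed : ∀ {X : Set} {A : X → Algebra} → (∀ i → A i ∈ K) → ∏ X A ∈ K

𝐕 : Algebra → Pred Algebra (lsuc (lsuc 0ℓ))
𝐕 A B = ∀ (K : Pred Algebra (lsuc 0ℓ)) → IsVariety K → A ∈ K → B ∈ K

------------------------------------------------------------------------
-- Finite pm-spaces; the topology is discrete and therefore omitted

record FinitePMSpace : Set₁ where
  infix 4 _≤_
  field
    Point             : Set
    points            : List Point
    complete          : ∀ x → x ∈ₗ points
    _≤_               : Rel Point 0ℓ
    isDecPartialOrder : IsDecPartialOrder _≡_ _≤_
    ζ                 : Point → Point
    ζ-involutive      : ∀ x → ζ (ζ x) ≡ x
    ζ-antitone        : ∀ {x y} → x ≤ y → ζ y ≤ ζ x

  open IsDecPartialOrder isDecPartialOrder public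
    using (_≤?_) renaming (refl to ≤-refl; trans to ≤-trans)

-- Subsets are decidable, given by their characteristic functions: these are
-- the continuous maps to the two-point space, i.e. the clopen subsets.
module Dual (Q : FinitePMSpace) where
  open FinitePMSpace Q

  record DecreasingSet : Set where
    field
      χ          : Point → Bool
      decreasing : ∀ {x y} → x ≤ y → T (χ y) → T (χ x)

  open DecreasingSet

  _∋_ : DecreasingSet → Point → Set
  X ∋ x = T (χ X x)

  UpSet : DecreasingSet → Pred Point 0ℓ
  UpSet X x = ∃ λ y → (X ∋ y) × (y ≤ x)

  upSet? : ∀ X → Decidable (UpSet X)
  upSet? X x = map′
    (λ a → let (y , _ , p) = find a in y , p)
    (λ (y , p) → lose (complete y) p)
    (any? (λ y → T? (χ X y) ×-dec (y ≤? x)) points)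

  private
    T-not : ∀ {b} → ¬ T b → T (not b)
    T-not {true}  f = f _
    T-not {false} _ = _

    T-not⁻ : ∀ {b} → T (not b) → ¬ T b
    T-not⁻ {false} _ ()

    not-antitone : ∀ {b c} → (T b → T c) → T (not c) → T (not b)
    not-antitone f t = T-not (T-not⁻ t ∘ f)

    ∧-mono : ∀ {a b c d} → (T a → T b) → (T c → T d) → T (a and c) → T (b and d)
    ∧-mono {true} {true}  f g t = g t
    ∧-mono {true} {false} f g t = f _

    ∨-mono : ∀ {a b c d} → (T a → T b) → (T c → T d) → T (a or c) → T (b or d)
    ∨-mono {_}     {true}          f g t = _
    ∨-mono {true}  {false}         f g t = ⊥-elim (f _)
    ∨-mono {false} {false}         f g t = g t

    does-mono : ∀ {P R : Set} (p : Dec P) (r : Dec R) → (P → R) → T (does p) → T (does r)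
    does-mono (yes p) (yes r) f _ = _
    does-mono (yes p) (no ¬r) f _ = ¬r (f p)

    does-cong : ∀ {P R : Set} (p : Dec P) (r : Dec R) → (P → R) → (R → P) → does p ≡ does r
    does-cong (yes _) (yes _) f g = ≡.refl
    does-cong (yes p) (no ¬r) f g = ⊥-elim (¬r (f p))
    does-cong (no ¬p) (yes r) f g = ⊥-elim (¬p (g r))
    does-cong (no _)  (no _)  f g = ≡.refl

    UpSet-⊆ : ∀ {X Y} → (∀ x → χ X x ≡ χ Y x) → ∀ {x} → UpSet X x → UpSet Y x
    UpSet-⊆ e (y , y∈X , y≤x) = y , subst T (e y) y∈X , y≤x

  -- Since ζ is its own inverse, x lies in the image ζ(X) iff ζ x lies in X.
  dual : Algebra
  dual = record
    { Carrier       = DecreasingSet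
    ; _≈_           = λ X Y → ∀ x → χ X x ≡ χ Y x
    ; isEquivalence = record
      { refl  = λ _ → ≡.refl
      ; sym   = λ e x → ≡.sym (e x)
      ; trans = λ e f x → ≡.trans (e x) (f x)
      }
    ; _∧_ = λ X Y → record
      { χ = λ x → χ X x and χ Y x
      ; decreasing = λ x≤y → ∧-mono (decreasing X x≤y) (decreasing Y x≤y) }
    ; _∨_ = λ X Y → record
      { χ = λ x → χ X x or χ Y x
      ; decreasing = λ x≤y →
          ∨-mono (decreasing X x≤y) (decreasing Y x≤y) }
    ; 𝟎 = record { χ = λ _ → false ; decreasing = λ _ t → t }
    ; 𝟏 = record { χ = λ _ → true  ; decreasing = λ _ t → t }
    ; _* = λ X → record
      { χ = λ x → not (does (upSet? X x))
      ; decreasing = λ {x} {y} x≤y → not-antitone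
          (does-mono (upSet? X x) (upSet? X y)
            (λ (z , z∈X , z≤x) → z , z∈X , ≤-trans z≤x x≤y)) }
    ; _′ = λ X → record
      { χ = λ x → not (χ X (ζ x))
      ; decreasing = λ x≤y → not-antitone (decreasing X (ζ-antitone x≤y)) }
    ; ∧-cong = λ e f x → cong₂ _and_ (e x) (f x)
    ; ∨-cong = λ e f x → cong₂ _or_ (e x) (f x)
    ; *-cong = λ {X} {Y} e x → cong not
        (does-cong (upSet? X x) (upSet? Y x)
          (UpSet-⊆ {X} {Y} e) (UpSet-⊆ {Y} {X} (≡.sym ∘ e)))
    ; ′-cong = λ e x → cong not (e (ζ x))
    }

open Dual using (dual) public

------------------------------------------------------------------------
-- The spaces Q₆(I,S), with S = Fin n

module _ {n : ℕ} (I : Subset n) where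

  -- inj₁ s is s ∈ S and inj₂ s is its copy ζ(s).
  Point₆ : Set
  Point₆ = Fin n ⊎ Fin n

  data _<₆_ : Rel Point₆ 0ℓ where
    below : ∀ {x y : Fin n} → x ≢ y ⊎ x ∉ₛ I → inj₁ x <₆ inj₂ y

  private
    _<₆?_ : Decidable₂ _<₆_
    inj₁ x <₆? inj₂ y =
      map′ below (λ { (below p) → p }) (¬? (x Fin.≟ y) ⊎-dec ¬? (x ∈ₛ? I))
    inj₁ x <₆? inj₁ y = no λ ()
    inj₂ x <₆? _      = no λ ()

    <₆-isStrictPartialOrder : IsStrictPartialOrder _≡_ _<₆_
    <₆-isStrictPartialOrder = record
      { isEquivalence = ≡.isEquivalence
      ; irrefl        = λ { ≡.refl () }
      ; trans         = λ { (below _) () }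
      ; <-resp-≈      = ≡.resp₂ _<₆_
      }

    <₆-isDecStrictPartialOrder : IsDecStrictPartialOrder _≡_ _<₆_
    <₆-isDecStrictPartialOrder = record
      { isStrictPartialOrder = <₆-isStrictPartialOrder
      ; _≟_  = ≡-dec Fin._≟_ Fin._≟_
      ; _<?_ = _<₆?_
      }

    enum : List Point₆
    enum = map inj₁ (allFin n) ++ map inj₂ (allFin n)

    enum-complete : ∀ x → x ∈ₗ enum
    enum-complete (inj₁ i) = ∈-++⁺ˡ (∈-map⁺ inj₁ (∈-allFin i))
    enum-complete (inj₂ i) = ∈-++⁺ʳ (map inj₁ (allFin n)) (∈-map⁺ inj₂ (∈-allFin i))

    flip : ∀ {x y : Fin n} → x ≢ y ⊎ x ∉ₛ I → y ≢ x ⊎ y ∉ₛ I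
    flip         (inj₁ x≢y) = inj₁ (x≢y ∘ ≡.sym)
    flip {x} {y} (inj₂ x∉I) with y Fin.≟ x
    ... | yes ≡.refl = inj₂ x∉I
    ... | no y≢x     = inj₁ y≢x

    swap-antitone : ∀ {x y} → ReflClosure _<₆_ x y → ReflClosure _<₆_ (swap y) (swap x)
    swap-antitone refl        = refl
    swap-antitone [ below p ] = [ below (flip p) ]

  Q₆ : FinitePMSpace
  Q₆ = record
    { Point             = Point₆
    ; points            = enum
    ; complete          = enum-complete
    ; _≤_               = ReflClosure _<₆_
    ; isDecPartialOrder = Refl.isDecPartialOrder <₆-isDecStrictPartialOrder
    ; ζ                 = swap
    ; ζ-involutive      = swap-involutive
    ; ζ-antitone        = swap-antitone
    }

  L₆ : Algebra
  L₆ = dual Q₆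

{-# OPTIONS --safe #-}

-- L₆(J) lies in 𝐕(L₆(I)) iff it embeds in L₆(I), that is, iff there is a surjective morphism
-- Q₆(I,S) → Q₆(J,T). For n ≥ 3 the term □ X = X′*′*′* is 1 at X = 1 and 0 elsewhere, so the
-- relations satisfied by the atoms {j} of L₆(J) can be conjoined into a single term which is
-- nonzero at those atoms, and nonzero somewhere in L₆(I) only if there is a morphism; its
-- vanishing defines a variety. A morphism is a partition of S into q blocks, of which p are
-- singletons of elements of I and none of the others is such a singleton. Among the n − p
-- elements not used by the p singletons, a block needs one element outside I or two inside,
-- whence at most ⌊(m − p)/2⌋ + (n − m) further blocks.

module Submission where

open import Defs
open import Level using (0ℓ; Lift; lift; lower) renaming (suc to lsuc)
import Data.Nat.Properties as ℕ
open import Algebra.Properties.CommutativeMonoid.Sum ℕ.+-0-commutativeMonoid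
  using (sum; sum-remove; ∑-comm; sum-cong-≗; sum-replicate-zero)
open import Data.Bool using (true; false; T; not; if_then_else_)
open import Data.Bool.Properties using (T?; T-∧; T-∨; T-not-≡)
open import Data.Fin using (Fin; zero; suc; toℕ)
import Data.Fin as Fin
import Data.Fin.Properties as Fin
open import Data.Fin.Subset using (Subset; ∣_∣; ∁; ⊤; inside; outside)
  renaming (_∈_ to _∈ₛ_; _∉_ to _∉ₛ_)
open import Data.Fin.Subset.Properties using (∈⊤; ∣p∣≡n⇒p≡⊤; ∣p∣≤n; ∣∁p∣≡n∸∣p∣)
  renaming (_∈?_ to _∈ₛ?_)
open import Data.Nat using (ℕ; zero; suc; _+_; _*_; _∸_; _≤_; _<_; _<?_; _≤?_; z≤n; s≤s;
  ⌊_/2⌋; ⌈_/2⌉; NonZero; >-nonZero)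
  renaming (_≟_ to _≟ℕ_)
open import Data.Nat.DivMod using (_mod_; m<n⇒m%n≡m)
import Data.Nat.Tactic.RingSolver as NatSolver
open import Data.Product using (∃; ∃₂; _×_; _,_; proj₁; proj₂)
open import Data.Sum as Sum using (_⊎_; inj₁; inj₂; swap; [_,_]′)
open import Data.Sum.Properties using (inj₁-injective)
open import Data.Vec using ([]; _∷_; lookup; here; there)
open import Data.Vec.Functional using (removeAt)
open import Data.Vec.Functional.Properties using (removeAt-punchOut)
open import Data.Vec.Properties using ([]=⇒lookup; lookup⇒[]=)
open import Function using (_∘_; id)
open import Function.Bundles using (_⇔_; mk⇔; Equivalence)
open import Relation.Binary.Construct.Closure.Reflexive using ([_])
import Relation.Binary.Construct.Closure.Reflexive as Refl
open import Relation.Binary.PropositionalEquality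
  using (_≡_; _≢_; refl; sym; trans; cong; cong₂; subst; subst₂; module ≡-Reasoning)
open import Relation.Nullary using (¬_; Dec; yes; no; does; contradiction)
open import Relation.Nullary.Decidable
  using (does-⇔; decidable-stable; _×-dec_; _⊎-dec_; ¬?)
open import Relation.Unary using (_∈_)

open Equivalence using (to; from)

-- Terms, and varieties defined by the vanishing of a term

data Term (V : Set) : Set where
  var     : V → Term V
  _∧_ _∨_ : Term V → Term V → Term V
  𝟎 𝟏     : Term V
  _* _′   : Term V → Term V

infixr 7 _∧_
infixr 6 _∨_
infix  8 _* _′

module _ (A : Algebra) {V : Set} (ρ : V → Algebra.Carrier A) where
  private module A = Algebra A

  eval : Term V → A.Carrier
  eval (var v) = ρ v
  eval (s ∧ t) = eval s A.∧ eval t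
  eval (s ∨ t) = eval s A.∨ eval t
  eval 𝟎       = A.𝟎
  eval 𝟏       = A.𝟏
  eval (t *)   = eval t A.*
  eval (t ′)   = eval t A.′

module _ {A B : Algebra} (h : Hom A B) where
  private
    module A = Algebra A
    module B = Algebra B
  open Hom h

  eval-homo : ∀ {V} {σ : V → A.Carrier} {ρ : V → B.Carrier} → (∀ v → ⟦ σ v ⟧ B.≈ ρ v) →
              ∀ t → ⟦ eval A σ t ⟧ B.≈ eval B ρ t
  eval-homo e (var v) = e v
  eval-homo e (s ∧ t) = B.trans (∧-homo _ _) (B.∧-cong (eval-homo e s) (eval-homo e t))
  eval-homo e (s ∨ t) = B.trans (∨-homo _ _) (B.∨-cong (eval-homo e s) (eval-homo e t))
  eval-homo e 𝟎       = 𝟎-homo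
  eval-homo e 𝟏       = 𝟏-homo
  eval-homo e (t *)   = B.trans (*-homo _) (B.*-cong (eval-homo e t))
  eval-homo e (t ′)   = B.trans (′-homo _) (B.′-cong (eval-homo e t))

projection : ∀ {X : Set} (A : X → Algebra) i → Hom (∏ X A) (A i)
projection A i = record
  { ⟦_⟧     = λ f → f i
  ; ⟦⟧-cong = λ e → e i
  ; ∧-homo  = λ _ _ → Algebra.refl (A i)
  ; ∨-homo  = λ _ _ → Algebra.refl (A i)
  ; 𝟎-homo  = Algebra.refl (A i)
  ; 𝟏-homo  = Algebra.refl (A i)
  ; *-homo  = λ _ → Algebra.refl (A i)
  ; ′-homo  = λ _ → Algebra.refl (A i)
  }

Vanishing : ∀ {V} → Term V → Algebra → Set
Vanishing t A = ∀ ρ → Algebra._≈_ A (eval A ρ t) (Algebra.𝟎 A)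

-- Assignments lift along a surjection, an embedding reflects the equation, and evaluation commutes
-- with projections. `Lift` only adjusts the universe level.
vanishing-isVariety : ∀ {V} (t : Term V) → IsVariety (Lift (lsuc 0ℓ) ∘ Vanishing t)
vanishing-isVariety t = record
  { H-closed = λ {A} {B} h onto (lift v) → lift λ ρ →
      let module B = Algebra B
          lifts  = λ x → proj₂ (onto (ρ x)) (Algebra.refl A)
      in B.trans (B.sym (eval-homo h lifts t))
           (B.trans (Hom.⟦⟧-cong h (v _)) (Hom.𝟎-homo h))
  ; S-closed = λ {A} {B} h embedding (lift v) → lift λ ρ →
      let module B = Algebra B
      in embedding (B.trans (eval-homo h (λ _ → B.refl) t)
           (B.trans (v _) (B.sym (Hom.𝟎-homo h))))
  ; P-closed = λ {_} {A} v → lift λ ρ i →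
      Algebra.trans (A i) (eval-homo (projection A i) (λ _ → Algebra.refl (A i)) t) (lower (v i) _)
  }

-- Foldings and the embeddings dual to them

-- The maps S → T that extend, by f ∘ ζ = ζ ∘ f, to surjective morphisms of pm-spaces
-- Q₆(I,S) → Q₆(J,T): the fibres over J are the singletons of elements of I, and every other
-- fibre is nonempty and not such a singleton.
record Folding {n q : ℕ} (I : Subset n) (J : Subset q) : Set where
  field
    fold  : Fin n → Fin q
    exact : ∀ x → fold x ∈ₛ J → x ∈ₛ I × (∀ y → fold y ≡ fold x → y ≡ x)
    thick : ∀ j → ∃ λ x → fold x ≡ j × (j ∉ₛ J → x ∉ₛ I ⊎ ∃ λ y → y ≢ x × fold y ≡ j)

module _ {n q : ℕ} {I : Subset n} {J : Subset q} (φ : Folding I J) where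
  open Folding φ
  private
    module QI = FinitePMSpace (Q₆ I)
    module QJ = FinitePMSpace (Q₆ J)
    module DI = Dual (Q₆ I)
    module DJ = Dual (Q₆ J)

  fold₆ : QI.Point → QJ.Point
  fold₆ = Sum.map fold fold

  fold₆-monotone : ∀ {x y} → x QI.≤ y → fold₆ x QJ.≤ fold₆ y
  fold₆-monotone Refl.refl = Refl.refl
  fold₆-monotone [ below {x} {y} x<ζy ] with fold x Fin.≟ fold y
  ... | no fx≢fy  = [ below (inj₁ fx≢fy) ]
  -- If the common image were in J, its fibre would be the single element x of I; then y = x, which
  -- excludes x < ζ(y).
  ... | yes fx≡fy = [ below (inj₂ λ fx∈J →
          let x∈I , unique = exact x fx∈J
          in [ (λ x≢y → x≢y (sym (unique y (sym fx≡fy)))) , (λ x∉I → x∉I x∈I) ]′ x<ζy) ]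

  -- This back condition is what makes taking preimages commute with `*`; monotonicity alone gives
  -- one inclusion.
  fold₆-lift : ∀ {y} x → y QJ.≤ fold₆ x → ∃ λ z → z QI.≤ x × fold₆ z ≡ y
  fold₆-lift x Refl.refl = x , Refl.refl , refl
  fold₆-lift (inj₂ a) [ below {b} b<ζfa ] with b Fin.≟ fold a | thick b
  ... | no b≢fa | x , fx≡b , _ =
    inj₁ x , [ below (inj₁ λ x≡a → b≢fa (trans (sym fx≡b) (cong fold x≡a))) ] , cong inj₁ fx≡b
  ... | yes b≡fa | x , fx≡b , t
    with t ([ (λ b≢fa → contradiction b≡fa b≢fa) , id ]′ b<ζfa)
  ... | inj₁ x∉I = inj₁ x , [ below (inj₂ x∉I) ] , cong inj₁ fx≡b
  -- Of the two distinct points x and y over b, at least one differs from a and so lies below ζ(a).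
  ... | inj₂ (y , y≢x , fy≡b) with x Fin.≟ a
  ...   | no x≢a   = inj₁ x , [ below (inj₁ x≢a) ] , cong inj₁ fx≡b
  ...   | yes refl = inj₁ y , [ below (inj₁ y≢x) ] , cong inj₁ fy≡b

  fold₆-swap : ∀ x → fold₆ (swap x) ≡ swap (fold₆ x)
  fold₆-swap (inj₁ _) = refl
  fold₆-swap (inj₂ _) = refl

  fold₆-surjective : ∀ y → ∃ λ x → fold₆ x ≡ y
  fold₆-surjective (inj₁ j) = let x , fx≡j , _ = thick j in inj₁ x , cong inj₁ fx≡j
  fold₆-surjective (inj₂ j) = let x , fx≡j , _ = thick j in inj₂ x , cong inj₂ fx≡j

  preimage : DJ.DecreasingSet → DI.DecreasingSet
  preimage X = record
    { χ          = χ ∘ fold₆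
    ; decreasing = decreasing ∘ fold₆-monotone
    }
    where open DJ.DecreasingSet X

  preimage-upSet : ∀ X x → DJ.UpSet X (fold₆ x) ⇔ DI.UpSet (preimage X) x
  preimage-upSet X x = mk⇔
    (λ (y , y∈X , y≤fx) → let z , z≤x , fz≡y = fold₆-lift x y≤fx in
       z , subst (T ∘ DJ.DecreasingSet.χ X) (sym fz≡y) y∈X , z≤x)
    (λ (z , z∈X , z≤x) → fold₆ z , z∈X , fold₆-monotone z≤x)

  preimageHom : Hom (L₆ J) (L₆ I)
  preimageHom = record
    { ⟦_⟧     = preimage
    ; ⟦⟧-cong = λ e x → e (fold₆ x)
    ; ∧-homo  = λ _ _ _ → refl
    ; ∨-homo  = λ _ _ _ → refl
    ; 𝟎-homo  = λ _ → refl
    ; 𝟏-homo  = λ _ → refl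
    ; *-homo  = λ X x → cong not
        (does-⇔ (preimage-upSet X x) (DJ.upSet? X (fold₆ x)) (DI.upSet? (preimage X) x))
    ; ′-homo  = λ X x → cong (not ∘ DJ.DecreasingSet.χ X) (sym (fold₆-swap x))
    }

  preimage-injective : IsEmbedding preimageHom
  preimage-injective {X} {Y} e y = let x , fx≡y = fold₆-surjective y in
    subst (λ z → DJ.DecreasingSet.χ X z ≡ DJ.DecreasingSet.χ Y z) fx≡y (e x)

folding⇒∈𝐕 : ∀ {n q} {I : Subset n} {J : Subset q} → Folding I J → L₆ J ∈ 𝐕 (L₆ I)
folding⇒∈𝐕 φ K isVariety = IsVariety.S-closed isVariety (preimageHom φ)
  λ {X} {Y} → preimage-injective φ {X} {Y}

-- The characteristic term of J

-- In an algebra L₆(I) with |S| ≥ 3 all of these take only the values 0 and 1: `◇ t` is 1 iff t is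
-- nonzero, `denseᵗ t` iff t contains S, and `thickᵗ t` iff every ζ(s) has an element of t in S
-- below it.
□ ◇ denseᵗ thickᵗ : ∀ {V} → Term V → Term V
□ t      = t ′ * ′ * ′ *
◇ t      = □ (t *) *
denseᵗ t = □ (t * *)
thickᵗ t = □ (t * ′ * ′)

disjointᵗ : ∀ {V} → Term V → Term V → Term V
disjointᵗ s t = □ ((s ∧ t) *)

infix 3 _⇒ᵗ_

-- The premise is decided while the term is being built; a false one leaves the neutral conjunct
-- `𝟏`.
_⇒ᵗ_ : ∀ {V} {P : Set} → Dec P → Term V → Term V
yes _ ⇒ᵗ t = t
no  _ ⇒ᵗ t = 𝟏

⋀ ⋁ : ∀ {V k} → (Fin k → Term V) → Term V
⋀ {k = zero}  f = 𝟏
⋀ {k = suc _} f = f zero ∧ ⋀ (f ∘ suc)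
⋁ {k = zero}  f = 𝟎
⋁ {k = suc _} f = f zero ∨ ⋁ (f ∘ suc)

-- The trace on S of the variable j plays the fibre over j. The conjuncts say that the traces cover
-- S, that they are disjoint, and that they have the shape which `Folding` demands: over J nonempty
-- but not thick, elsewhere thick.
characteristicTerm : ∀ {q} → Subset q → Term (Fin q)
characteristicTerm J =
  denseᵗ (⋁ var)
  ∧ ⋀ (λ i → ⋀ (λ j → ¬? (i Fin.≟ j) ⇒ᵗ disjointᵗ (var i) (var j)))
  ∧ ⋀ (λ j → (j ∈ₛ? J ⇒ᵗ thickᵗ (var j) * ∧ ◇ (var j)) ∧ (¬? (j ∈ₛ? J) ⇒ᵗ thickᵗ (var j)))

-- Pointwise membership in the values of terms

twoOthers : ∀ {n} → 3 ≤ n → (s : Fin n) → ∃₂ λ a b → a ≢ s × b ≢ s × a ≢ b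
twoOthers (s≤s (s≤s (s≤s _))) zero          = suc zero , suc (suc zero) , (λ ()) , (λ ()) , λ ()
twoOthers (s≤s (s≤s (s≤s _))) (suc zero)    = zero , suc (suc zero) , (λ ()) , (λ ()) , λ ()
twoOthers (s≤s (s≤s (s≤s _))) (suc (suc _)) = zero , suc zero , (λ ()) , (λ ()) , λ ()

T-not : ∀ {b} → T (not b) ⇔ (¬ T b)
T-not {true}  = mk⇔ (λ ()) (λ ¬t → ¬t _)
T-not {false} = mk⇔ (λ _ ()) (λ _ → _)

T-does : ∀ {P : Set} (P? : Dec P) → T (does P?) ⇔ P
T-does (yes p) = mk⇔ (λ _ → p) (λ _ → _)
T-does (no ¬p) = mk⇔ (λ ()) ¬p

module Forcing {n : ℕ} (3≤n : 3 ≤ n) (I : Subset n) {V : Set} (ρ : V → Algebra.Carrier (L₆ I)) where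
  open FinitePMSpace (Q₆ I) using (Point; ≤-refl; ζ) renaming (_≤_ to _⊑_)
  open Dual (Q₆ I) using (upSet?)
  open Dual.DecreasingSet

  infix 4 _⊩_

  -- A record rather than a synonym, so that `x` and `t` can be recovered by unification.
  record _⊩_ (x : Point) (t : Term V) : Set where
    constructor ⟨_⟩
    field member : T (χ (eval (L₆ I) ρ t) x)
  open _⊩_ public

  _⊩?_ : ∀ x t → Dec (x ⊩ t)
  x ⊩? t with T? (χ (eval (L₆ I) ρ t) x)
  ... | yes p = yes ⟨ p ⟩
  ... | no ¬p = no λ { ⟨ p ⟩ → ¬p p }

  stable : ∀ {x t} → ¬ ¬ (x ⊩ t) → x ⊩ t
  stable = decidable-stable (_ ⊩? _)

  ⊩-decreasing : ∀ {x y t} → x ⊑ y → y ⊩ t → x ⊩ t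
  ⊩-decreasing {t = t} x⊑y ⟨ p ⟩ = ⟨ decreasing (eval (L₆ I) ρ t) x⊑y p ⟩

  ⊩-∧ : ∀ {x s t} → x ⊩ s ∧ t ⇔ (x ⊩ s × x ⊩ t)
  ⊩-∧ = mk⇔ (λ { ⟨ p ⟩ → let a , b = to T-∧ p in ⟨ a ⟩ , ⟨ b ⟩ })
             (λ { (⟨ a ⟩ , ⟨ b ⟩) → ⟨ from T-∧ (a , b) ⟩ })

  ⊩-∨ : ∀ {x s t} → x ⊩ s ∨ t ⇔ (x ⊩ s ⊎ x ⊩ t)
  ⊩-∨ = mk⇔ (λ { ⟨ p ⟩ → Sum.map ⟨_⟩ ⟨_⟩ (to T-∨ p) })
             (λ p → ⟨ from T-∨ (Sum.map member member p) ⟩)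

  ⊩-* : ∀ {x t} → x ⊩ t * ⇔ (∀ y → y ⊑ x → ¬ y ⊩ t)
  ⊩-* {x} {t} = mk⇔
    (λ { ⟨ p ⟩ y y⊑x ⟨ q ⟩ → to T-not p (from (T-does u?) (y , q , y⊑x)) })
    (λ f → ⟨ from T-not (λ q → let y , r , y⊑x = to (T-does u?) q in f y y⊑x ⟨ r ⟩) ⟩)
    where u? = upSet? (eval (L₆ I) ρ t) x

  ⊩-′ : ∀ {x t} → x ⊩ t ′ ⇔ (¬ ζ x ⊩ t)
  ⊩-′ = mk⇔ (λ { ⟨ p ⟩ ⟨ q ⟩ → to T-not p q }) (λ f → ⟨ from T-not (f ∘ ⟨_⟩) ⟩)

  ⊩-⇒ : ∀ {P : Set} {P? : Dec P} {x t} → x ⊩ (P? ⇒ᵗ t) ⇔ (P → x ⊩ t)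
  ⊩-⇒ {P? = yes p} = mk⇔ (λ f _ → f) (λ f → f p)
  ⊩-⇒ {P? = no ¬p} = mk⇔ (λ _ p → contradiction p ¬p) (λ _ → ⟨ _ ⟩)

  ⊩-⋀ : ∀ {k x} {f : Fin k → Term V} → x ⊩ ⋀ f ⇔ (∀ j → x ⊩ f j)
  ⊩-⋀ = mk⇔ elim intro
    where
    elim : ∀ {k x} {f : Fin k → Term V} → x ⊩ ⋀ f → ∀ j → x ⊩ f j
    elim p zero    = proj₁ (to ⊩-∧ p)
    elim p (suc j) = elim (proj₂ (to ⊩-∧ p)) j

    intro : ∀ {k x} {f : Fin k → Term V} → (∀ j → x ⊩ f j) → x ⊩ ⋀ f
    intro {zero}  p = ⟨ _ ⟩
    intro {suc k} p = from ⊩-∧ (p zero , intro (p ∘ suc))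

  ⊩-⋁ : ∀ {k x} {f : Fin k → Term V} → x ⊩ ⋁ f ⇔ ∃ λ j → x ⊩ f j
  ⊩-⋁ = mk⇔ elim (λ (j , p) → intro j p)
    where
    elim : ∀ {k x} {f : Fin k → Term V} → x ⊩ ⋁ f → ∃ λ j → x ⊩ f j
    elim {suc k} p with to ⊩-∨ p
    ... | inj₁ q = zero , q
    ... | inj₂ q = let j , r = elim q in suc j , r
    elim {zero} ⟨ () ⟩

    intro : ∀ {k x} {f : Fin k → Term V} j → x ⊩ f j → x ⊩ ⋁ f
    intro zero    p = from ⊩-∨ (inj₁ p)
    intro (suc j) p = from ⊩-∨ (inj₂ (intro j p))

  below-≢ : ∀ {x y} → x ≢ y → inj₁ x ⊑ inj₂ y
  below-≢ x≢y = [ below (inj₁ x≢y) ]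

  below-inj₁ : ∀ {s y} → y ⊑ inj₁ s → y ≡ inj₁ s
  below-inj₁ Refl.refl = refl

  minimalBelow : ∀ x → ∃ λ s → inj₁ s ⊑ x
  minimalBelow (inj₁ s) = s , ≤-refl
  minimalBelow (inj₂ s) = let a , _ , a≢s , _ = twoOthers 3≤n s in a , below-≢ a≢s

  □-intro : ∀ {t} → (∀ y → y ⊩ t) → ∀ x → x ⊩ □ t
  □-intro f _ = from ⊩-* λ _ _ a → to ⊩-′ a (from ⊩-* λ _ _ b → to ⊩-′ b (from ⊩-* λ _ _ c →
    to ⊩-′ c (f _)))

  -- Stripping one ′ * at a time, the known points of ζ(S) grow from one to two (as |S| ≥ 3) and
  -- then to all, since no element of S equals both of two distinct ones.
  □-elim : ∀ {x t} → x ⊩ □ t → ∀ y → y ⊩ t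
  □-elim {x} {t} p = λ where
      (inj₁ c) → let a , _ , a≢c , _ = twoOthers 3≤n c in
                 ⊩-decreasing (below-≢ (a≢c ∘ sym)) (top a)
      (inj₂ c) → top c
    where
    step : ∀ {s y} → y ⊩ s ′ * → ∀ c → inj₁ c ⊑ y → inj₂ c ⊩ s
    step q c c⊑y = stable λ ¬r → to ⊩-* q (inj₁ c) c⊑y (from ⊩-′ ¬r)

    top : ∀ c → inj₂ c ⊩ t
    top c with minimalBelow x
    ... | s , s⊑x with twoOthers 3≤n s
    ... | a , b , a≢s , b≢s , a≢b with c Fin.≟ a
    ... | no c≢a   = step (step (step p s s⊑x) a (below-≢ a≢s)) c (below-≢ c≢a)
    ... | yes refl = step (step (step p s s⊑x) b (below-≢ b≢s)) c (below-≢ a≢b)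

  ◇-intro : ∀ {t y} → y ⊩ t → ∀ x → x ⊩ ◇ t
  ◇-intro p _ = from ⊩-* λ _ _ q → to ⊩-* (□-elim q _) _ ≤-refl p

  -- Every point has an element of S below it, so a `t` that misses S is empty.
  ◇-elim : ∀ {t x} → x ⊩ ◇ t → ∃ λ s → inj₁ s ⊩ t
  ◇-elim {t} {x} p with Fin.any? (λ s → inj₁ s ⊩? t)
  ... | yes q = q
  ... | no ¬q = contradiction
    (□-intro (λ _ → from ⊩-* λ z _ r → let s , s⊑z = minimalBelow z in ¬q (s , ⊩-decreasing s⊑z r)) x)
    (to ⊩-* p x ≤-refl)

  dense-intro : ∀ {t} → (∀ s → inj₁ s ⊩ t) → ∀ x → x ⊩ denseᵗ t
  dense-intro f = □-intro λ _ → from ⊩-* λ y _ p →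
    let s , s⊑y = minimalBelow y in to ⊩-* p (inj₁ s) s⊑y (f s)

  -- At a minimal point `t * *` is merely the double negation of `t`, which decidability removes.
  dense-elim : ∀ {t x} → x ⊩ denseᵗ t → ∀ s → inj₁ s ⊩ t
  dense-elim {t} p s = stable λ ¬q → to ⊩-* (□-elim p (inj₁ s)) (inj₁ s) ≤-refl
    (from ⊩-* λ y y⊑s r → ¬q (subst (_⊩ t) (below-inj₁ y⊑s) r))

  disjoint-intro : ∀ {s t} → (∀ y → y ⊩ s → ¬ y ⊩ t) → ∀ x → x ⊩ disjointᵗ s t
  disjoint-intro f = □-intro λ _ → from ⊩-* λ y _ p → let a , b = to ⊩-∧ p in f y a b

  disjoint-elim : ∀ {s t x} → x ⊩ disjointᵗ s t → ∀ y → y ⊩ s → ¬ y ⊩ t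
  disjoint-elim p y a b = to ⊩-* (□-elim p y) y ≤-refl (from ⊩-∧ (a , b))

  -- The trace of t on S is neither empty nor the singleton of an element of I.
  Thick : Term V → Set
  Thick t = ∀ s → ∃ λ a → inj₁ a ⊩ t × (a ≢ s ⊎ a ∉ₛ I)

  thick-intro : ∀ {t} → Thick t → ∀ x → x ⊩ thickᵗ t
  thick-intro f = □-intro λ _ → from ⊩-′ λ p →
    let s , s⊑y = minimalBelow _
        a , q , r = f s
    in to ⊩-* p (inj₁ s) s⊑y (from ⊩-′ λ u → to ⊩-* u (inj₁ a) [ below r ] q)

  thick-elim : ∀ {t x} → x ⊩ thickᵗ t → Thick t
  thick-elim {t} p s with Fin.any? (λ a → (inj₁ a ⊩? t) ×-dec (¬? (a Fin.≟ s) ⊎-dec ¬? (a ∈ₛ? I)))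
  ... | yes q = q
  -- The test point is `inj₂ s` because its ζ-image `inj₁ s` is minimal: the outer `*` then sees
  -- only that point, and the inner one exactly the points below `inj₂ s`.
  ... | no ¬q = contradiction (from ⊩-* noneBelow) (to ⊩-′ (□-elim p (inj₂ s)))
    where
    upper : ¬ inj₂ s ⊩ t
    -- ζ(s) itself is no exception: if it were in the decreasing set `t`, so would be an element of
    -- S other than s.
    upper r = let a , _ , a≢s , _ = twoOthers 3≤n s in
      ¬q (a , ⊩-decreasing (below-≢ a≢s) r , inj₁ a≢s)

    none : ∀ y → y ⊑ inj₂ s → ¬ y ⊩ t
    none _        Refl.refl   = upper
    none (inj₁ a) [ below d ] = λ r → ¬q (a , r , d)

    noneBelow : ∀ y → y ⊑ inj₁ s → ¬ y ⊩ t * ′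
    noneBelow _ Refl.refl r = to ⊩-′ r (from ⊩-* none)

-- A folding from any point of the characteristic term

point : ∀ {n} → 3 ≤ n → Fin n
point (s≤s _) = zero

module _ {n q : ℕ} (3≤n : 3 ≤ n) {I : Subset n} {J : Subset q}
         (ρ : Fin q → Algebra.Carrier (L₆ I)) where
  open Forcing 3≤n I ρ

  -- Over J, thickness fails, and this excludes both an element outside I and a second element of
  -- the fibre, since either would make the trace thick.
  traceFolding : (fold : Fin n → Fin q) →
                 (∀ s → inj₁ s ⊩ var (fold s)) →
                 (∀ {s j} → inj₁ s ⊩ var j → fold s ≡ j) →
                 (∀ {j} → j ∈ₛ J → ¬ Thick (var j)) →
                 (∀ {j} → j ∈ₛ J → ∃ λ s → inj₁ s ⊩ var j) →
                 (∀ {j} → j ∉ₛ J → Thick (var j)) →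
                 Folding I J
  traceFolding fold fold-⊩ unique notThick nonempty thick = record
    { fold  = fold
    ; exact = λ s fs∈J →
          decidable-stable (s ∈ₛ? I) (λ s∉I → notThick fs∈J λ _ → s , fold-⊩ s , inj₂ s∉I)
        , λ y fy≡fs → decidable-stable (y Fin.≟ s) λ y≢s → notThick fs∈J (twoPoints fy≡fs y≢s)
    ; thick = surjective
    }
    where
    twoPoints : ∀ {s y} → fold y ≡ fold s → y ≢ s → Thick (var (fold s))
    twoPoints {s} {y} fy≡fs y≢s r with s Fin.≟ r
    ... | no s≢r   = s , fold-⊩ s , inj₁ s≢r
    ... | yes refl = y , subst (λ j → inj₁ y ⊩ var j) fy≡fs (fold-⊩ y) , inj₁ y≢s

    surjective : ∀ j → ∃ λ s → fold s ≡ j × (j ∉ₛ J → s ∉ₛ I ⊎ ∃ λ y → y ≢ s × fold y ≡ j)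
    surjective j with j ∈ₛ? J
    ... | yes j∈J = let s , r = nonempty j∈J in s , unique r , contradiction j∈J
    -- Thickness is used twice: against an arbitrary point, to find some s in the fibre, then
    -- against s, to find a second element or one outside I.
    ... | no j∉J with thick j∉J (point 3≤n)
    ... | s , r , _ with thick j∉J s
    ... | y , u , inj₁ y≢s = s , unique r , λ _ → inj₂ (y , y≢s , unique u)
    ... | y , u , inj₂ y∉I = y , unique u , λ _ → inj₁ y∉I

  characteristic⇒folding : ∀ {x} → x ⊩ characteristicTerm J → Folding I J
  characteristic⇒folding {x} p = traceFolding
    (proj₁ ∘ covered)
    (proj₂ ∘ covered)
    (disjoint (proj₂ (covered _)))
    (λ j∈J t → to ⊩-* (proj₁ (inside-J j∈J)) x Refl.refl (thick-intro t x))
    (λ j∈J → ◇-elim (proj₂ (inside-J j∈J)))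
    (λ {j} j∉J → thick-elim (to ⊩-⇒ (proj₂ (conditions j)) j∉J))
    where
    rest       = to ⊩-∧ (proj₂ (to ⊩-∧ p))
    conditions = λ j → to ⊩-∧ (to ⊩-⋀ (proj₂ rest) j)
    inside-J   = λ {j} j∈J → to ⊩-∧ (to ⊩-⇒ (proj₁ (conditions j)) j∈J)

    covered : ∀ s → ∃ λ j → inj₁ s ⊩ var j
    covered s = to ⊩-⋁ (dense-elim (proj₁ (to ⊩-∧ p)) s)

    disjoint : ∀ {s i j} → inj₁ s ⊩ var i → inj₁ s ⊩ var j → i ≡ j
    disjoint {s} {i} {j} a b = decidable-stable (i Fin.≟ j) λ i≢j →
      disjoint-elim (to ⊩-⇒ (to ⊩-⋀ (to ⊩-⋀ (proj₁ rest) i) j) i≢j) (inj₁ s) a b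

-- The atoms of L₆(J) and the separating variety

module _ {q : ℕ} (3≤q : 3 ≤ q) (J : Subset q) where

  atom : Fin q → Algebra.Carrier (L₆ J)
  atom j = record
    { χ          = λ { (inj₁ s) → does (s Fin.≟ j) ; (inj₂ _) → false }
    ; decreasing = λ { Refl.refl → id ; [ below _ ] () }
    }

  open Forcing 3≤q J atom

  ⊩-atom : ∀ {s j} → inj₁ s ⊩ var j ⇔ s ≡ j
  ⊩-atom = mk⇔ (λ { ⟨ p ⟩ → to (T-does (_ Fin.≟ _)) p }) (λ e → ⟨ from (T-does (_ Fin.≟ _)) e ⟩)

  atoms-disjoint : ∀ {i j} → i ≢ j → ∀ y → y ⊩ var i → ¬ y ⊩ var j
  atoms-disjoint i≢j (inj₁ s) a b = i≢j (trans (sym (to ⊩-atom a)) (to ⊩-atom b))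
  atoms-disjoint i≢j (inj₂ s) ⟨ () ⟩ _

  -- The only possible witness is j itself, so the decisive test is whether j lies below ζ(j).
  thick-atom : ∀ {j} → Thick (var j) ⇔ j ∉ₛ J
  thick-atom {j} = mk⇔ notInJ (λ j∉J _ → j , from ⊩-atom refl , inj₂ j∉J)
    where
    notInJ : Thick (var j) → j ∉ₛ J
    notInJ t with t j
    ... | a , p , d with to ⊩-atom p
    ... | refl = [ contradiction refl , id ]′ d

  characteristic-atom : ∀ x → x ⊩ characteristicTerm J
  characteristic-atom x = from ⊩-∧
    ( dense-intro (λ s → from ⊩-⋁ (s , from ⊩-atom refl)) x
    , from ⊩-∧
      ( from ⊩-⋀ (λ i → from ⊩-⋀ λ j → from ⊩-⇒ λ i≢j → disjoint-intro (atoms-disjoint i≢j) x)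
      , from ⊩-⋀ λ j → from ⊩-∧
        ( from ⊩-⇒ (λ j∈J → from ⊩-∧
            ( from ⊩-* (λ _ _ p → to thick-atom (thick-elim p) j∈J)
            , ◇-intro (from (⊩-atom {j} {j}) refl) x))
        , from ⊩-⇒ (λ j∉J → thick-intro (from thick-atom j∉J) x)) ) )

-- Without a folding the characteristic term vanishes on L₆(I), hence on L₆(J), where the atoms
-- refute it. The double negation is harmless, since the numerical condition to be derived is
-- decidable.
∈𝐕⇒¬¬folding : ∀ {n q} → 3 ≤ n → 3 ≤ q → {I : Subset n} {J : Subset q} →
               L₆ J ∈ 𝐕 (L₆ I) → ¬ ¬ Folding I J
∈𝐕⇒¬¬folding 3≤n 3≤q {I} {J} v ¬φ =
  subst T (vanishes (atom 3≤q J) x) (Forcing.member (characteristic-atom 3≤q J x))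
  where
  x : Point₆ J
  x = inj₁ (point 3≤q)

  vanishes : Vanishing (characteristicTerm J) (L₆ J)
  vanishes = lower (v _ (vanishing-isVariety (characteristicTerm J)) (lift λ ρ x →
    to T-not-≡ (from T-not λ p → ¬φ (characteristic⇒folding 3≤n ρ Forcing.⟨ p ⟩))))

-- Weighing the fibres: necessity of the numerical condition

sum-mono : ∀ {k} {v w : Fin k → ℕ} → (∀ i → v i ≤ w i) → sum v ≤ sum w
sum-mono {zero}  _   = z≤n
sum-mono {suc k} v≤w = ℕ.+-mono-≤ (v≤w zero) (sum-mono (v≤w ∘ suc))

term≤sum : ∀ {k} (w : Fin k → ℕ) i → w i ≤ sum w
term≤sum {suc k} w i = subst (w i ≤_) (sym (sum-remove {i = i} w)) (ℕ.m≤m+n _ _)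

twoTerms≤sum : ∀ {k} (w : Fin k → ℕ) {i j} → i ≢ j → w i + w j ≤ sum w
twoTerms≤sum {suc k} w {i} {j} i≢j = begin
  w i + w j                                ≡⟨ cong (w i +_) (removeAt-punchOut w i≢j) ⟨
  w i + removeAt w i (Fin.punchOut i≢j)    ≤⟨ ℕ.+-monoʳ-≤ (w i) (term≤sum (removeAt w i) _) ⟩
  w i + sum (removeAt w i)                 ≡⟨ sum-remove {i = i} w ⟨
  sum w                                    ∎
  where open ℕ.≤-Reasoning

sum-delta : ∀ {k} (i : Fin k) c → sum (λ j → if does (i Fin.≟ j) then c else 0) ≡ c
sum-delta {suc k} zero    c = trans (cong (c +_) (sum-replicate-zero k)) (ℕ.+-identityʳ c)
sum-delta {suc k} (suc i) c = sum-delta i c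

if-yes : ∀ {P A : Set} (P? : Dec P) {a b : A} → P → (if does P? then a else b) ≡ a
if-yes (yes _) _ = refl
if-yes (no ¬p) p = contradiction p ¬p

module _ {n q : ℕ} (f : Fin n → Fin q) where

  fibre : (Fin n → ℕ) → Fin q → Fin n → ℕ
  fibre w j x = if does (f x Fin.≟ j) then w x else 0

  fibre-≡ : ∀ w {j x} → f x ≡ j → fibre w j x ≡ w x
  fibre-≡ w {j} {x} e = if-yes (f x Fin.≟ j) e

  -- After exchanging the two summations, each x contributes its weight once, at `f x`.
  sum-fibres : ∀ w → sum (λ j → sum (fibre w j)) ≡ sum w
  sum-fibres w = trans (∑-comm (fibre w)) (sum-cong-≗ λ x → sum-delta (f x) (w x))

  sum≤sum-fibrewise : ∀ {v w} → (∀ j → v j ≤ sum (fibre w j)) → sum v ≤ sum w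
  sum≤sum-fibrewise {_} {w} v≤ = subst (_ ≤_) (sum-fibres w) (sum-mono v≤)

weight : ∀ {n} → Subset n → ℕ → ℕ → Fin n → ℕ
weight I a b x = if lookup I x then a else b

weight-∈ : ∀ {n} {I : Subset n} {a b x} → x ∈ₛ I → weight I a b x ≡ a
weight-∈ x∈I = cong (if_then _ else _) ([]=⇒lookup x∈I)

weight-∉ : ∀ {n} {I : Subset n} {a b x} → x ∉ₛ I → weight I a b x ≡ b
weight-∉ {I = I} {x = x} x∉I with lookup I x in eq
... | true  = contradiction (lookup⇒[]= x I eq) x∉I
... | false = refl

sum-weight : ∀ {n} (I : Subset n) a b → sum (weight I a b) ≡ ∣ I ∣ * a + ∣ ∁ I ∣ * b
sum-weight []            a b = refl
sum-weight (inside  ∷ I) a b = trans (cong (a +_) (sum-weight I a b)) (sym (ℕ.+-assoc a _ _))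
sum-weight (outside ∷ I) a b = begin
  b + sum (weight I a b)             ≡⟨ cong (b +_) (sum-weight I a b) ⟩
  b + (∣ I ∣ * a + ∣ ∁ I ∣ * b)      ≡⟨ rotate (∣ I ∣ * a) (∣ ∁ I ∣ * b) b ⟩
  ∣ I ∣ * a + (b + ∣ ∁ I ∣ * b)      ∎
  where
  open ≡-Reasoning
  rotate : ∀ x y z → z + (x + y) ≡ x + (z + y)
  rotate = NatSolver.solve-∀

weight-≥1 : ∀ {n} (I : Subset n) x → 1 ≤ weight I 1 2 x
weight-≥1 I x with lookup I x
... | true  = s≤s z≤n
... | false = s≤s z≤n

module _ {n q : ℕ} {I : Subset n} {J : Subset q} (φ : Folding I J) where
  open Folding φ

  -- With weight 1 on I and J and weight 2 elsewhere, every fibre is at least as heavy as its image.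
  folding-weight : ∣ J ∣ * 1 + ∣ ∁ J ∣ * 2 ≤ ∣ I ∣ * 1 + ∣ ∁ I ∣ * 2
  folding-weight = subst₂ _≤_ (sum-weight J 1 2) (sum-weight I 1 2) (sum≤sum-fibrewise fold heavy)
    where
    open ℕ.≤-Reasoning
    w = weight I 1 2

    heavy : ∀ j → weight J 1 2 j ≤ sum (fibre fold w j)
    heavy j with thick j | j ∈ₛ? J
    ... | x , fx≡j , _ | yes j∈J = begin
      weight J 1 2 j         ≡⟨ weight-∈ j∈J ⟩
      1                      ≤⟨ weight-≥1 I x ⟩
      w x                    ≡⟨ fibre-≡ fold w fx≡j ⟨
      fibre fold w j x       ≤⟨ term≤sum _ x ⟩
      sum (fibre fold w j)   ∎
    ... | x , fx≡j , t | no j∉J with t j∉J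
    ... | inj₁ x∉I = begin
      weight J 1 2 j         ≡⟨ weight-∉ j∉J ⟩
      2                      ≡⟨ weight-∉ x∉I ⟨
      w x                    ≡⟨ fibre-≡ fold w fx≡j ⟨
      fibre fold w j x       ≤⟨ term≤sum _ x ⟩
      sum (fibre fold w j)   ∎
    ... | inj₂ (y , y≢x , fy≡j) = begin
      weight J 1 2 j                         ≡⟨ weight-∉ j∉J ⟩
      2                                      ≤⟨ ℕ.+-mono-≤ (weight-≥1 I y) (weight-≥1 I x) ⟩
      w y + w x                              ≡⟨ cong₂ _+_ (fibre-≡ fold w fy≡j) (fibre-≡ fold w fx≡j) ⟨
      fibre fold w j y + fibre fold w j x    ≤⟨ twoTerms≤sum _ y≢x ⟩
      sum (fibre fold w j)                   ∎

  -- The same weighing with weight 1 inside and 0 outside: by `exact`, a fibre over J contains an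
  -- element of I.
  folding-∣∣ : ∣ J ∣ ≤ ∣ I ∣
  folding-∣∣ = subst₂ _≤_ (count J) (count I) (sum≤sum-fibrewise fold heavy)
    where
    count : ∀ {k} (K : Subset k) → sum (weight K 1 0) ≡ ∣ K ∣
    count K = trans (sum-weight K 1 0)
      (trans (cong₂ _+_ (ℕ.*-identityʳ ∣ K ∣) (ℕ.*-zeroʳ ∣ ∁ K ∣)) (ℕ.+-identityʳ ∣ K ∣))

    open ℕ.≤-Reasoning
    w = weight I 1 0

    heavy : ∀ j → weight J 1 0 j ≤ sum (fibre fold w j)
    heavy j with thick j | j ∈ₛ? J
    ... | x , refl , _ | yes fx∈J = begin
      weight J 1 0 (fold x)        ≡⟨ weight-∈ fx∈J ⟩
      1                            ≡⟨ weight-∈ (proj₁ (exact x fx∈J)) ⟨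
      w x                          ≡⟨ fibre-≡ fold w refl ⟨
      fibre fold w (fold x) x      ≤⟨ term≤sum _ x ⟩
      sum (fibre fold w (fold x))  ∎
    ... | _ | no j∉J = subst (_≤ _) (sym (weight-∉ j∉J)) z≤n

half-bound : ∀ {u} r o → u + u ≤ r + (o + o) → u ≤ ⌊ r /2⌋ + o
half-bound {u} r o h = begin
  u                     ≡⟨ ℕ.n≡⌊n+n/2⌋ u ⟩
  ⌊ u + u /2⌋           ≤⟨ ℕ.⌊n/2⌋-mono h ⟩
  ⌊ r + (o + o) /2⌋     ≡⟨ halves o ⟩
  ⌊ r /2⌋ + o           ∎
  where
  open ℕ.≤-Reasoning
  halves : ∀ k → ⌊ r + (k + k) /2⌋ ≡ ⌊ r /2⌋ + k
  halves zero    = trans (cong ⌊_/2⌋ (ℕ.+-identityʳ r)) (sym (ℕ.+-identityʳ _))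
  halves (suc k) = trans (cong ⌊_/2⌋ (shift r k)) (trans (cong suc (halves k)) (sym (ℕ.+-suc _ k)))
    where
    shift : ∀ r k → r + (suc k + suc k) ≡ 2 + (r + (k + k))
    shift = NatSolver.solve-∀

Condition : (m n p q : ℕ) → Set
Condition m n p q = p ≤ m × ((p ≡ q × q ≡ m × m ≡ n) ⊎ (p < q × q ≤ (p + ⌊ m ∸ p /2⌋) + (n ∸ m)))

condition? : ∀ m n p q → Dec (Condition m n p q)
condition? m n p q = p ≤? m ×-dec
  ((p ≟ℕ q ×-dec (q ≟ℕ m ×-dec m ≟ℕ n)) ⊎-dec (p <? q ×-dec q ≤? (p + ⌊ m ∸ p /2⌋) + (n ∸ m)))

folding⇒condition : ∀ {n q} {I : Subset n} {J : Subset q} →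
                    Folding I J → Condition (∣ I ∣) n (∣ J ∣) q
folding⇒condition {n} {q} {I} {J} φ = folding-∣∣ φ , cases
  where
  open Folding φ
  m = ∣ I ∣
  p = ∣ J ∣

  cases : (p ≡ q × q ≡ m × m ≡ n) ⊎ (p < q × q ≤ (p + ⌊ m ∸ p /2⌋) + (n ∸ m))
  cases with p ≟ℕ q
  -- Here J is everything, so `exact` makes `fold` injective and m ≤ n ≤ q = p ≤ m.
  ... | yes p≡q = inj₁ (p≡q , ℕ.≤-antisym q≤m (ℕ.≤-trans (∣p∣≤n I) n≤q)
                            , ℕ.≤-antisym (∣p∣≤n I) (ℕ.≤-trans n≤q q≤m))
    where
    q≤m : q ≤ m
    q≤m = subst (_≤ m) p≡q (folding-∣∣ φ)

    everywhere : ∀ j → j ∈ₛ J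
    everywhere j = subst (j ∈ₛ_) (sym (∣p∣≡n⇒p≡⊤ p≡q)) ∈⊤

    n≤q : n ≤ q
    n≤q = Fin.injective⇒≤ {f = fold} λ {x} {y} fx≡fy → proj₂ (exact y (everywhere (fold y))) x fx≡fy
  ... | no p≢q = inj₂ (ℕ.≤∧≢⇒< (∣p∣≤n J) p≢q , (begin
    q                                     ≡⟨ ℕ.m+[n∸m]≡n (∣p∣≤n J) ⟨
    p + (q ∸ p)                           ≤⟨ ℕ.+-monoʳ-≤ p (half-bound (m ∸ p) (n ∸ m) bound) ⟩
    p + (⌊ m ∸ p /2⌋ + (n ∸ m))           ≡⟨ ℕ.+-assoc p _ _ ⟨
    (p + ⌊ m ∸ p /2⌋) + (n ∸ m)           ∎))
    where
    open ℕ.≤-Reasoning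
    double : ∀ a b → a * 1 + b * 2 ≡ a + (b + b)
    double = NatSolver.solve-∀

    -- The weight inequality reads p + 2(q - p) ≤ m + 2(n - m); p is cancelled from both sides.
    bound : (q ∸ p) + (q ∸ p) ≤ (m ∸ p) + ((n ∸ m) + (n ∸ m))
    bound = ℕ.+-cancelˡ-≤ p _ _ (begin
      p + ((q ∸ p) + (q ∸ p))                ≡⟨ cong (λ u → p + (u + u)) (∣∁p∣≡n∸∣p∣ J) ⟨
      p + (∣ ∁ J ∣ + ∣ ∁ J ∣)                ≡⟨ double p ∣ ∁ J ∣ ⟨
      p * 1 + ∣ ∁ J ∣ * 2                    ≤⟨ folding-weight φ ⟩
      m * 1 + ∣ ∁ I ∣ * 2                    ≡⟨ double m ∣ ∁ I ∣ ⟩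
      m + (∣ ∁ I ∣ + ∣ ∁ I ∣)                ≡⟨ cong₂ (λ k o → k + (o + o))
                                                      (ℕ.m+[n∸m]≡n (folding-∣∣ φ)) (sym (∣∁p∣≡n∸∣p∣ I)) ⟨
      (p + (m ∸ p)) + ((n ∸ m) + (n ∸ m))    ≡⟨ ℕ.+-assoc p _ _ ⟩
      p + ((m ∸ p) + ((n ∸ m) + (n ∸ m)))    ∎)

-- Building a folding: sufficiency of the numerical condition

-- With inverse `unrank`, this numbers I and its complement separately, so that a folding can be
-- built from cardinalities alone.
rank : ∀ {n} (I : Subset n) → Fin n → Fin ∣ I ∣ ⊎ Fin ∣ ∁ I ∣
rank (inside  ∷ I) zero    = inj₁ zero
rank (inside  ∷ I) (suc x) = Sum.map₁ suc (rank I x)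
rank (outside ∷ I) zero    = inj₂ zero
rank (outside ∷ I) (suc x) = Sum.map₂ suc (rank I x)

unrank : ∀ {n} (I : Subset n) → Fin ∣ I ∣ ⊎ Fin ∣ ∁ I ∣ → Fin n
unrank (inside  ∷ I) (inj₁ zero)    = zero
unrank (inside  ∷ I) (inj₁ (suc i)) = suc (unrank I (inj₁ i))
unrank (inside  ∷ I) (inj₂ k)       = suc (unrank I (inj₂ k))
unrank (outside ∷ I) (inj₁ i)       = suc (unrank I (inj₁ i))
unrank (outside ∷ I) (inj₂ zero)    = zero
unrank (outside ∷ I) (inj₂ (suc k)) = suc (unrank I (inj₂ k))

rank-unrank : ∀ {n} (I : Subset n) r → rank I (unrank I r) ≡ r
rank-unrank (inside  ∷ I) (inj₁ zero)    = refl
rank-unrank (inside  ∷ I) (inj₁ (suc i)) = cong (Sum.map₁ suc) (rank-unrank I (inj₁ i))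
rank-unrank (inside  ∷ I) (inj₂ k)       = cong (Sum.map₁ suc) (rank-unrank I (inj₂ k))
rank-unrank (outside ∷ I) (inj₁ i)       = cong (Sum.map₂ suc) (rank-unrank I (inj₁ i))
rank-unrank (outside ∷ I) (inj₂ zero)    = refl
rank-unrank (outside ∷ I) (inj₂ (suc k)) = cong (Sum.map₂ suc) (rank-unrank I (inj₂ k))

unrank-rank : ∀ {n} (I : Subset n) x → unrank I (rank I x) ≡ x
unrank-rank (inside  ∷ I) zero    = refl
unrank-rank (inside  ∷ I) (suc x) with rank I x | unrank-rank I x
... | inj₁ _ | e = cong suc e
... | inj₂ _ | e = cong suc e
unrank-rank (outside ∷ I) zero    = refl
unrank-rank (outside ∷ I) (suc x) with rank I x | unrank-rank I x
... | inj₁ _ | e = cong suc e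
... | inj₂ _ | e = cong suc e

unrank-inj₁ : ∀ {n} (I : Subset n) i → unrank I (inj₁ i) ∈ₛ I
unrank-inj₁ (inside  ∷ I) zero    = here
unrank-inj₁ (inside  ∷ I) (suc i) = there (unrank-inj₁ I i)
unrank-inj₁ (outside ∷ I) i       = there (unrank-inj₁ I i)

unrank-inj₂ : ∀ {n} (I : Subset n) k → unrank I (inj₂ k) ∉ₛ I
unrank-inj₂ (inside  ∷ I) k       (there p) = unrank-inj₂ I k p
unrank-inj₂ (outside ∷ I) (suc k) (there p) = unrank-inj₂ I k p

toℕ-mod : ∀ {u} .{{_ : NonZero u}} (c : Fin u) → toℕ c mod u ≡ c
toℕ-mod c = Fin.toℕ-injective (trans (Fin.toℕ-fromℕ< _) (m<n⇒m%n≡m (Fin.toℕ<n c)))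

-- Ensures that both members 2k and 2k + 1 of the k-th pair are among r elements.
double<half : ∀ {k r} → k < ⌊ r /2⌋ → suc (k + k) < r
double<half {k} {r} k<⌊r/2⌋ = begin
  suc (suc (k + k))        ≡⟨ cong suc (ℕ.+-suc k k) ⟨
  suc k + suc k            ≤⟨ ℕ.+-mono-≤ k<⌊r/2⌋ k<⌊r/2⌋ ⟩
  ⌊ r /2⌋ + ⌊ r /2⌋        ≤⟨ ℕ.+-monoʳ-≤ ⌊ r /2⌋ (ℕ.⌊n/2⌋≤⌈n/2⌉ r) ⟩
  ⌊ r /2⌋ + ⌈ r /2⌉        ≡⟨ ℕ.⌊n/2⌋+⌈n/2⌉≡n r ⟩
  r                        ∎
  where open ℕ.≤-Reasoning

-- Elements of I and of its complement are numbered from 0. The first p elements of I go to J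
-- in order; then the fibres off J are filled by single elements outside I and, from number o
-- on, by pairs of elements of I. Reduction mod u only accommodates the surplus elements.
module Assignment (m o p u : ℕ) .{{_ : NonZero u}} (p≤m : p ≤ m) where

  assign : Fin m ⊎ Fin o → Fin p ⊎ Fin u
  assign (inj₂ k) = inj₂ (toℕ k mod u)
  assign (inj₁ i) with toℕ i <? p
  ... | yes i<p = inj₁ (Fin.fromℕ< i<p)
  ... | no  _   = inj₂ ((o + ⌊ toℕ i ∸ p /2⌋) mod u)

  assign-low : ∀ j → assign (inj₁ (Fin.inject≤ j p≤m)) ≡ inj₁ j
  assign-low j with toℕ (Fin.inject≤ j p≤m) <? p
  ... | yes i<p = cong inj₁ (Fin.toℕ-injective (trans (Fin.toℕ-fromℕ< i<p) (Fin.toℕ-inject≤ j p≤m)))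
  ... | no  i≮p = contradiction (subst (_< p) (sym (Fin.toℕ-inject≤ j p≤m)) (Fin.toℕ<n j)) i≮p

  assign-low⁻¹ : ∀ {x j} → assign x ≡ inj₁ j → x ≡ inj₁ (Fin.inject≤ j p≤m)
  assign-low⁻¹ {inj₁ i} e with toℕ i <? p
  assign-low⁻¹ {inj₁ i} refl | yes i<p = cong inj₁ (Fin.toℕ-injective
    (sym (trans (Fin.toℕ-inject≤ _ p≤m) (Fin.toℕ-fromℕ< i<p))))

  assign-high : ∀ {k} (p+k<m : p + k < m) →
                assign (inj₁ (Fin.fromℕ< p+k<m)) ≡ inj₂ ((o + ⌊ k /2⌋) mod u)
  assign-high {k} p+k<m with toℕ (Fin.fromℕ< p+k<m) <? p
  ... | yes i<p = contradiction (subst (_< p) (Fin.toℕ-fromℕ< p+k<m) i<p) (ℕ.m+n≮m p k)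
  ... | no  _   = cong (λ i → inj₂ ((o + ⌊ i /2⌋) mod u))
    (trans (cong (_∸ p) (Fin.toℕ-fromℕ< p+k<m)) (ℕ.m+n∸m≡n p k))

  Filled : Fin u → Set
  Filled c = (∃ λ k → assign (inj₂ k) ≡ inj₂ c)
           ⊎ (∃₂ λ i i′ → i′ ≢ i × assign (inj₁ i) ≡ inj₂ c × assign (inj₁ i′) ≡ inj₂ c)

  filled : u ≤ ⌊ m ∸ p /2⌋ + o → ∀ c → Filled c
  filled u≤ c with toℕ c <? o
  ... | yes c<o = inj₁ (Fin.fromℕ< c<o , cong inj₂
          (trans (cong (_mod u) (Fin.toℕ-fromℕ< c<o)) (toℕ-mod c)))
  -- The fibre number c is filled by the pair numbered k = c - o, at the offsets 2k and 2k + 1 past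
  -- p; both halve to k, as `⌈ k + k /2⌉` is by definition `⌊ suc (k + k) /2⌋`.
  ... | no  c≮o = inj₂ (Fin.fromℕ< even<m , Fin.fromℕ< odd<m , distinct ,
          hits even<m (sym (ℕ.n≡⌊n+n/2⌋ k)) , hits odd<m (sym (ℕ.n≡⌈n+n/2⌉ k)))
    where
    o≤c = ℕ.≮⇒≥ c≮o
    k   = toℕ c ∸ o

    k<half : k < ⌊ m ∸ p /2⌋
    k<half = subst (k <_) (ℕ.m+n∸n≡m _ o) (ℕ.∸-monoˡ-< (ℕ.<-≤-trans (Fin.toℕ<n c) u≤) o≤c)

    odd<m : p + suc (k + k) < m
    odd<m = subst (p + suc (k + k) <_) (ℕ.m+[n∸m]≡n p≤m) (ℕ.+-monoʳ-< p (double<half {r = m ∸ p} k<half))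

    even<m : p + (k + k) < m
    even<m = ℕ.<-trans (ℕ.+-monoʳ-< p (ℕ.n<1+n (k + k))) odd<m

    distinct : Fin.fromℕ< odd<m ≢ Fin.fromℕ< even<m
    distinct e = ℕ.1+n≢n (ℕ.+-cancelˡ-≡ p _ _
      (trans (sym (Fin.toℕ-fromℕ< odd<m)) (trans (cong toℕ e) (Fin.toℕ-fromℕ< even<m))))

    hits : ∀ {i} (p+i<m : p + i < m) → ⌊ i /2⌋ ≡ k → assign (inj₁ (Fin.fromℕ< p+i<m)) ≡ inj₂ c
    hits p+i<m e = trans (assign-high p+i<m) (cong inj₂
      (trans (cong (_mod u) (trans (cong (o +_) e) (ℕ.m+[n∸m]≡n o≤c))) (toℕ-mod c)))

module _ {n q : ℕ} (I : Subset n) (J : Subset q) .{{_ : NonZero ∣ ∁ J ∣}} (∣J∣≤∣I∣ : ∣ J ∣ ≤ ∣ I ∣)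
         (room : ∣ ∁ J ∣ ≤ ⌊ ∣ I ∣ ∸ ∣ J ∣ /2⌋ + ∣ ∁ I ∣) where
  open Assignment (∣ I ∣) (∣ ∁ I ∣) (∣ J ∣) (∣ ∁ J ∣) ∣J∣≤∣I∣

  assignmentFolding : Folding I J
  assignmentFolding = record { fold = fold ; exact = exact ; thick = thick }
    where
    fold : Fin n → Fin q
    fold x = unrank J (assign (rank I x))

    fold-unrank : ∀ r {s} → assign r ≡ s → fold (unrank I r) ≡ unrank J s
    fold-unrank r e = cong (unrank J) (trans (cong assign (rank-unrank I r)) e)

    unrank-injective : ∀ {r s} → unrank I r ≡ unrank I s → r ≡ s
    unrank-injective e = trans (sym (rank-unrank I _)) (trans (cong (rank I) e) (rank-unrank I _))

    low : ∀ x {j} → rank J (fold x) ≡ inj₁ j → x ≡ unrank I (inj₁ (Fin.inject≤ j ∣J∣≤∣I∣))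
    low x e = trans (sym (unrank-rank I x))
      (cong (unrank I) (assign-low⁻¹ (trans (sym (rank-unrank J _)) e)))

    exact : ∀ x → fold x ∈ₛ J → x ∈ₛ I × (∀ y → fold y ≡ fold x → y ≡ x)
    exact x fx∈J with rank J (fold x) in e
    ... | inj₁ j = subst (_∈ₛ I) (sym (low x e)) (unrank-inj₁ I _)
                 , λ y fy≡fx → trans (low y (trans (cong (rank J) fy≡fx) e)) (sym (low x e))
    ... | inj₂ c = contradiction
      (subst (_∈ₛ J) (trans (sym (unrank-rank J _)) (cong (unrank J) e)) fx∈J) (unrank-inj₂ J c)

    Covered : Fin q → Set
    Covered j = ∃ λ x → fold x ≡ j × (j ∉ₛ J → x ∉ₛ I ⊎ ∃ λ y → y ≢ x × fold y ≡ j)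

    covered : ∀ r → Covered (unrank J r)
    covered (inj₁ j) = unrank I (inj₁ (Fin.inject≤ j ∣J∣≤∣I∣)) , fold-unrank _ (assign-low j)
                     , contradiction (unrank-inj₁ J j)
    covered (inj₂ c) with filled room c
    ... | inj₁ (k , e) = unrank I (inj₂ k) , fold-unrank _ e , λ _ → inj₁ (unrank-inj₂ I k)
    ... | inj₂ (i , i′ , i′≢i , e , e′) = unrank I (inj₁ i) , fold-unrank _ e
        , λ _ → inj₂ (unrank I (inj₁ i′) , i′≢i ∘ inj₁-injective ∘ unrank-injective , fold-unrank _ e′)

    thick : ∀ j → Covered j
    thick j = subst Covered (unrank-rank J j) (covered (rank J j))

-- Serves case (a), where no fibres lie off J and `Assignment` would lack a nonzero modulus.
fullFolding : ∀ {n} → Folding (⊤ {n}) (⊤ {n})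
fullFolding = record
  { fold  = id
  ; exact = λ _ _ → ∈⊤ , λ _ → id
  ; thick = λ j → j , refl , contradiction ∈⊤
  }

condition⇒folding : ∀ {n q} (I : Subset n) (J : Subset q) →
                    Condition (∣ I ∣) n (∣ J ∣) q → Folding I J
condition⇒folding I J (_ , inj₁ (p≡q , q≡m , m≡n)) =
  both-full I J p≡q m≡n (trans q≡m m≡n)
  where
  both-full : ∀ {n q} (I : Subset n) (J : Subset q) → ∣ J ∣ ≡ q → ∣ I ∣ ≡ n → q ≡ n → Folding I J
  both-full I J p≡q m≡n refl with ∣p∣≡n⇒p≡⊤ {p = I} m≡n | ∣p∣≡n⇒p≡⊤ {p = J} p≡q
  ... | refl | refl = fullFolding
condition⇒folding {n} {q} I J (p≤m , inj₂ (p<q , q≤)) =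
  -- From p < q the complement of J is nonempty, which supplies the nonzero modulus.
  assignmentFolding I J {{>-nonZero (subst (0 <_) (sym (∣∁p∣≡n∸∣p∣ J)) (ℕ.m<n⇒0<n∸m p<q))}} p≤m (begin
    ∣ ∁ J ∣                              ≡⟨ ∣∁p∣≡n∸∣p∣ J ⟩
    q ∸ p                                ≤⟨ ℕ.∸-monoˡ-≤ p q≤ ⟩
    (p + ⌊ m ∸ p /2⌋) + (n ∸ m) ∸ p      ≡⟨ cong (_∸ p) (ℕ.+-assoc p _ _) ⟩
    p + (⌊ m ∸ p /2⌋ + (n ∸ m)) ∸ p      ≡⟨ ℕ.m+n∸m≡n p _ ⟩
    ⌊ m ∸ p /2⌋ + (n ∸ m)                ≡⟨ cong (⌊ m ∸ p /2⌋ +_) (∣∁p∣≡n∸∣p∣ I) ⟨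
    ⌊ m ∸ p /2⌋ + ∣ ∁ I ∣                ∎)
  where
  open ℕ.≤-Reasoning
  m = ∣ I ∣
  p = ∣ J ∣

-- The membership criterion

theorem5p5 : ∀ (m n p q : ℕ) → 3 ≤ n → 3 ≤ q → m ≤ n → p ≤ q →
    (I : Subset n) (J : Subset q) → ∣ I ∣ ≡ m → ∣ J ∣ ≡ p →
    (L₆ J ∈ 𝐕 (L₆ I)) ⇔
    (p ≤ m × ((p ≡ q × q ≡ m × m ≡ n) ⊎ (p < q × q ≤ (p + ⌊ m ∸ p /2⌋) + (n ∸ m))))
theorem5p5 m n p q 3≤n 3≤q _ _ I J refl refl = mk⇔
  (λ v → decidable-stable (condition? m n p q) λ ¬c →
    ∈𝐕⇒¬¬folding 3≤n 3≤q v (¬c ∘ folding⇒condition))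
  (folding⇒∈𝐕 ∘ condition⇒folding I J)
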